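{- The function $\mathsf{ExpLen}_M(\cdot):[0,1]\to\mathbb{R}\cup\{+\infty\}$ is in general not monotonic, neither in $\Lambda_A$ nor in $\Lambda_I$: there exists a term $M\in\Lambda_A$ such that $\mathsf{ExpLen}_M$ is neither non-decreasing nor non-increasing on $[0,1]$, and there exists a term $M\in\Lambda_I$ such that $\mathsf{ExpLen}_M$ is neither non-decreasing nor non-increasing on $[0,1]$.
   Context: $\lambda$-terms: $\Lambda$ is the set of untyped $\lambda$-terms $M,N ::= x \mid MN \mid \lambda x.M$ ($x$ in a countably infinite set of variables), modulo $\alpha$-equivalence. A $\beta$-redex is a term $(\lambda x.M)N$; its contractum is $M\{N/x\}$ (capture-avoiding substitution). $M\to_\beta N$ means that $N$ is obtained from $M$ by replacing one occurrence of a redex in $M$ (anywhere in the term) by its contractum. A term is in normal form if it has no $\beta$-reduct, reducible otherwise. $\Lambda_A$ (resp. $\Lambda_I$) is the set of terms such that for every subterm $\lambda x.N$, the variable $x$ occurs free at most once (resp. at least once) in $N$. Terms may contain free variables. The leftmost-outermost ($\mathsf{LO}$) redex of a reducible term is the leftmost among its redexes, and the rightmost-innermost ($\mathsf{RI}$) redex is the rightmost among its redexes, the position of a redex being measured by its beginning symbol in the written term. $\mathsf{LO}(M)$, $\mathsf{RI}(M)$ denote the terms obtained from $M$ by firing these redexes. For $\varepsilon\in[0,1]$, the randomised strategy $\mathsf{P}_\varepsilon$ assigns to each reducible term $M$ the distribution $\mathsf{P}_\varepsilon(M)=\varepsilon\,\delta_{\mathsf{LO}(M)}+(1-\varepsilon)\,\delta_{\mathsf{RI}(M)}$;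 it is undefined on normal forms. Put $\mathbb{P}(M\to N)=\mathsf{P}_\varepsilon(M)(N)$ if $M$ is reducible, $0$ if $M$ is a normal form. The computation starting from $M$ is the sequence $(\rho_i)_{i\in\mathbb{N}}$ with $\rho_0$ the Dirac distribution at $M$ and $\rho_{i+1}(N)=\sum_{L}\rho_i(L)\,\mathbb{P}(L\to N)$. Write $|\rho|=\sum_N\rho(N)$ and $\mathsf{ExpLen}_M(\varepsilon)=\sum_{i=1}^\infty|\rho_i|\in\mathbb{R}\cup\{+\infty\}$. -}

module Defs where

open import Data.Empty using (⊥-elim)
open import Data.List.Base using
  (List; []; _∷_; _++_; map; foldr; head; last; concatMap; deduplicate; fromMaybe)
open import Data.List.Membership.Propositional using (_∈_; _∉_)
open import Data.List.Membership.Propositional.Properties using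
  (∈-++⁺ˡ; ∈-++⁺ʳ; ∈-deduplicate⁺)
open import Data.List.Relation.Unary.Any using (here; there)
open import Data.Maybe.Base as Maybe using (Maybe; just; nothing; maybe′)
open import Data.Nat.Base as ℕ using (ℕ; zero; suc)
import Data.Nat.Properties as ℕₚ
open import Data.Product.Base using (Σ; ∃; _×_; _,_; proj₁)
open import Data.Rational.Base as ℚ using (ℚ; 0ℚ; 1ℚ; ∣_∣)
import Data.Rational.Properties as ℚₚ
import Data.Rational.Solver as ℚSolver
open import Function.Base using (flip; _∘_)
open import Relation.Binary.Core using (Rel; _Preserves_⟶_)
open import Relation.Binary.Definitions using (DecidableEquality)
open import Relation.Binary.PropositionalEquality using
  (_≡_; refl; sym; trans; cong; cong₂; subst)
open import Relation.Nullary using (¬_; yes; no)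
open import Relation.Nullary.Decidable using (map′; _×-dec_)

infixl 7 _·_
infix  6 ƛ_

-- De Bruijn indices: an index pointing beyond all enclosing binders is a
-- free variable, so there are countably many of them.
data Term : Set where
  var : ℕ → Term
  _·_ : Term → Term → Term
  ƛ_  : Term → Term

infix 4 _≟_

_≟_ : DecidableEquality Term
var x   ≟ var y   = map′ (cong var) (λ { refl → refl }) (x ℕₚ.≟ y)
var _   ≟ (_ · _) = no λ ()
var _   ≟ (ƛ _)   = no λ ()
(_ · _) ≟ var _   = no λ ()
(M · N) ≟ (P · Q) = map′ (λ { (refl , refl) → refl }) (λ { refl → refl , refl })
                         ((M ≟ P) ×-dec (N ≟ Q))
(_ · _) ≟ (ƛ _)   = no λ ()
(ƛ _)   ≟ var _   = no λ ()
(ƛ _)   ≟ (_ · _) = no λ ()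
(ƛ M)   ≟ (ƛ N)   = map′ (cong ƛ_) (λ { refl → refl }) (M ≟ N)

ext : (ℕ → ℕ) → ℕ → ℕ
ext r zero    = zero
ext r (suc x) = suc (r x)

rename : (ℕ → ℕ) → Term → Term
rename r (var x) = var (r x)
rename r (M · N) = rename r M · rename r N
rename r (ƛ M)   = ƛ rename (ext r) M

exts : (ℕ → Term) → ℕ → Term
exts s zero    = var zero
exts s (suc x) = rename suc (s x)

sub : (ℕ → Term) → Term → Term
sub s (var x) = s x
sub s (M · N) = sub s M · sub s N
sub s (ƛ M)   = ƛ sub (exts s) M

-- M [ N ] is M{N/x}, where x is the variable with index 0 in M.
_[_] : Term → Term → Term
M [ N ] = sub (λ { zero → N ; (suc x) → var x }) M

-- Free occurrences of the variable x; in ƛ M, those of the bound variable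
-- are counted by occ 0 M.
occ : ℕ → Term → ℕ
occ x (var y) with x ℕₚ.≟ y
... | yes _ = 1
... | no  _ = 0
occ x (M · N) = occ x M ℕ.+ occ x N
occ x (ƛ M)   = occ (suc x) M

infix 4 _⊑_

data _⊑_ (N : Term) : Term → Set where
  self : N ⊑ N
  appˡ : ∀ {P Q} → N ⊑ P → N ⊑ P · Q
  appʳ : ∀ {P Q} → N ⊑ Q → N ⊑ P · Q
  body : ∀ {P} → N ⊑ P → N ⊑ ƛ P

Λ-A : Term → Set
Λ-A M = ∀ N → ƛ N ⊑ M → occ 0 N ℕ.≤ 1

Λ-I : Term → Set
Λ-I M = ∀ N → ƛ N ⊑ M → 1 ℕ.≤ occ 0 N

root : Term → Term → List Term
root (var _) N = []
root (_ · _) N = []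
root (ƛ M)   N = M [ N ] ∷ []

-- One entry for each redex occurrence, namely the term obtained by firing
-- it.  The entries are ordered by the position of the beginning symbol of
-- the redex, from left to right: if M · N is itself a redex, it begins
-- before every redex inside M, and those begin before every redex inside N.
reducts : Term → List Term
reducts (var _) = []
reducts (M · N) = root M N ++ map (_· N) (reducts M) ++ map (M ·_) (reducts N)
reducts (ƛ M)   = map ƛ_ (reducts M)

-- Both are nothing exactly on normal forms.
LO RI : Term → Maybe Term
LO M = head (reducts M)
RI M = last (reducts M)

Cauchy : (ℕ → ℚ) → Set
Cauchy x = ∀ δ → 0ℚ ℚ.< δ →
  ∃ λ N → ∀ m n → N ℕ.≤ m → N ℕ.≤ n → ∣ x m ℚ.- x n ∣ ℚ.< δ

-- Two Cauchy sequences x and y denote the same real when x ≤ᴿ y and y ≤ᴿ x;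
-- ℝ is not quotiented.
record ℝ : Set where
  constructor mkℝ
  field
    seq    : ℕ → ℚ
    cauchy : Cauchy seq

open ℝ public

private
  open ℚSolver.+-*-Solver using (solve; _:=_; _:+_; _:*_; _:-_)

  +-diff : ∀ a b c d → (a ℚ.+ b) ℚ.- (c ℚ.+ d) ≡ (a ℚ.- c) ℚ.+ (b ℚ.- d)
  +-diff = solve 4 (λ a b c d → (a :+ b) :- (c :+ d) := (a :- c) :+ (b :- d)) refl

  -+-cancel : ∀ a b → (a ℚ.- b) ℚ.+ b ≡ a
  -+-cancel a b = trans (ℚₚ.+-assoc a (ℚ.- b) b)
                        (trans (cong (a ℚ.+_) (ℚₚ.+-inverseˡ b)) (ℚₚ.+-identityʳ a))

  *-diff : ∀ a b c d →
    a ℚ.* b ℚ.- c ℚ.* d ≡ a ℚ.* (b ℚ.- d) ℚ.+ d ℚ.* (a ℚ.- c)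
  *-diff = solve 4 (λ a b c d → a :* b :- c :* d := a :* (b :- d) :+ d :* (a :- c)) refl

  abstract
    halve : ∀ δ → 0ℚ ℚ.< δ → ∃ λ η → 0ℚ ℚ.< η × η ℚ.+ η ≡ δ
    halve δ 0<δ = ℚ.½ ℚ.* δ
      , subst (ℚ._< ℚ.½ ℚ.* δ) (ℚₚ.*-zeroʳ ℚ.½) (ℚₚ.*-monoʳ-<-pos ℚ.½ 0<δ)
      , trans (sym (ℚₚ.*-distribʳ-+ δ ℚ.½ ℚ.½)) (ℚₚ.*-identityˡ δ)

    const-cauchy : ∀ q → Cauchy (λ _ → q)
    const-cauchy q δ 0<δ = 0 , λ _ _ _ _ →
      subst (ℚ._< δ) (cong ∣_∣ (sym (ℚₚ.+-inverseʳ q))) 0<δ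

    +-cauchy : ∀ x y → Cauchy x → Cauchy y → Cauchy (λ n → x n ℚ.+ y n)
    +-cauchy x y cx cy δ 0<δ with halve δ 0<δ
    ... | η , 0<η , η+η≡δ with cx η 0<η | cy η 0<η
    ... | A , hA | B , hB = A ℕ.⊔ B , λ m n p q → begin-strict
        ∣ (x m ℚ.+ y m) ℚ.- (x n ℚ.+ y n) ∣
          ≡⟨ cong ∣_∣ (+-diff (x m) (y m) (x n) (y n)) ⟩
        ∣ (x m ℚ.- x n) ℚ.+ (y m ℚ.- y n) ∣
          ≤⟨ ℚₚ.∣p+q∣≤∣p∣+∣q∣ (x m ℚ.- x n) (y m ℚ.- y n) ⟩
        ∣ x m ℚ.- x n ∣ ℚ.+ ∣ y m ℚ.- y n ∣
          <⟨ ℚₚ.+-mono-< (hA m n (ℕₚ.m⊔n≤o⇒m≤o A B p) (ℕₚ.m⊔n≤o⇒m≤o A B q))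
                         (hB m n (ℕₚ.m⊔n≤o⇒n≤o A B p) (ℕₚ.m⊔n≤o⇒n≤o A B q)) ⟩
        η ℚ.+ η
          ≡⟨ η+η≡δ ⟩
        δ ∎
      where open ℚₚ.≤-Reasoning

    neg-cauchy : ∀ x → Cauchy x → Cauchy (λ n → ℚ.- x n)
    neg-cauchy x cx δ 0<δ with cx δ 0<δ
    ... | A , hA = A , λ m n p q → subst (ℚ._< δ)
      (trans (sym (ℚₚ.∣-p∣≡∣p∣ (x m ℚ.- x n)))
             (cong ∣_∣ (ℚₚ.neg-distrib-+ (x m) (ℚ.- x n))))
      (hA m n p q)

    0<1 : 0ℚ ℚ.< 1ℚ
    0<1 = ℚₚ.positive⁻¹ 1ℚ

    bound : ∀ x → Cauchy x →
      ∃ λ N → ∃ λ B → 0ℚ ℚ.< B × (∀ n → N ℕ.≤ n → ∣ x n ∣ ℚ.≤ B)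
    bound x cx with cx 1ℚ 0<1
    ... | N , h = N , 1ℚ ℚ.+ ∣ x N ∣
        , ℚₚ.+-mono-<-≤ 0<1 (ℚₚ.0≤∣p∣ (x N))
        , λ n p → begin
        ∣ x n ∣
          ≡⟨ cong ∣_∣ (sym (-+-cancel (x n) (x N))) ⟩
        ∣ (x n ℚ.- x N) ℚ.+ x N ∣
          ≤⟨ ℚₚ.∣p+q∣≤∣p∣+∣q∣ (x n ℚ.- x N) (x N) ⟩
        ∣ x n ℚ.- x N ∣ ℚ.+ ∣ x N ∣
          ≤⟨ ℚₚ.+-monoˡ-≤ ∣ x N ∣ (ℚₚ.<⇒≤ (h n N p ℕₚ.≤-refl)) ⟩
        1ℚ ℚ.+ ∣ x N ∣ ∎
      where open ℚₚ.≤-Reasoning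

    divide : ∀ B δ → 0ℚ ℚ.< B → 0ℚ ℚ.< δ → ∃ λ η → 0ℚ ℚ.< η × B ℚ.* η ≡ δ
    divide B δ 0<B 0<δ = η , 0<η , eq
      where
      instance
        B⁺ : ℚ.Positive B
        B⁺ = ℚ.positive 0<B
        B≢0 : ℚ.NonZero B
        B≢0 = ℚₚ.pos⇒nonZero B
        1/B⁺ : ℚ.Positive (ℚ.1/ B)
        1/B⁺ = ℚₚ.1/pos⇒pos B
      η : ℚ
      η = ℚ.1/ B ℚ.* δ
      0<η : 0ℚ ℚ.< η
      0<η = subst (ℚ._< η) (ℚₚ.*-zeroʳ (ℚ.1/ B)) (ℚₚ.*-monoʳ-<-pos (ℚ.1/ B) 0<δ)
      eq : B ℚ.* η ≡ δ
      eq = trans (sym (ℚₚ.*-assoc B (ℚ.1/ B) δ))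
                 (trans (cong (ℚ._* δ) (ℚₚ.*-inverseʳ B)) (ℚₚ.*-identityˡ δ))

    ≤-* : ∀ a b {A B} → ∣ a ∣ ℚ.≤ A → ∣ b ∣ ℚ.≤ B → 0ℚ ℚ.≤ A →
          ∣ a ℚ.* b ∣ ℚ.≤ A ℚ.* B
    ≤-* a b {A} {B} p q 0≤A = begin
      ∣ a ℚ.* b ∣       ≡⟨ ℚₚ.∣p*q∣≡∣p∣*∣q∣ a b ⟩
      ∣ a ∣ ℚ.* ∣ b ∣   ≤⟨ ℚₚ.*-monoʳ-≤-nonNeg ∣ b ∣ {{ℚₚ.∣-∣-nonNeg b}} p ⟩
      A ℚ.* ∣ b ∣       ≤⟨ ℚₚ.*-monoˡ-≤-nonNeg A {{ℚ.nonNegative 0≤A}} q ⟩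
      A ℚ.* B           ∎
      where open ℚₚ.≤-Reasoning

    *-cauchy : ∀ x y → Cauchy x → Cauchy y → Cauchy (λ n → x n ℚ.* y n)
    *-cauchy x y cx cy δ 0<δ with bound x cx | bound y cy | halve δ 0<δ
    ... | A , X , 0<X , hX | B , Y , 0<Y , hY | γ , 0<γ , γ+γ≡δ
      with halve γ 0<γ
    ... | β , 0<β , β+β≡γ
      with divide Y β 0<Y 0<β | divide X β 0<X 0<β
    ... | η , 0<η , Yη≡β | θ , 0<θ , Xθ≡β
      with cx η 0<η | cy θ 0<θ
    ... | C , hC | D , hD = (A ℕ.⊔ B) ℕ.⊔ (C ℕ.⊔ D) , λ m n p q → begin-strict
        ∣ x m ℚ.* y m ℚ.- x n ℚ.* y n ∣
          ≡⟨ cong ∣_∣ (*-diff (x m) (y m) (x n) (y n)) ⟩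
        ∣ x m ℚ.* (y m ℚ.- y n) ℚ.+ y n ℚ.* (x m ℚ.- x n) ∣
          ≤⟨ ℚₚ.∣p+q∣≤∣p∣+∣q∣ (x m ℚ.* (y m ℚ.- y n)) (y n ℚ.* (x m ℚ.- x n)) ⟩
        ∣ x m ℚ.* (y m ℚ.- y n) ∣ ℚ.+ ∣ y n ℚ.* (x m ℚ.- x n) ∣
          ≤⟨ ℚₚ.+-mono-≤
               (≤-* (x m) _ (hX m (inA p)) (ℚₚ.<⇒≤ (hD m n (inD p) (inD q))) (ℚₚ.<⇒≤ 0<X))
               (≤-* (y n) _ (hY n (inB q)) (ℚₚ.<⇒≤ (hC m n (inC p) (inC q))) (ℚₚ.<⇒≤ 0<Y)) ⟩
        X ℚ.* θ ℚ.+ Y ℚ.* η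
          ≡⟨ cong₂ ℚ._+_ Xθ≡β Yη≡β ⟩
        β ℚ.+ β
          ≡⟨ β+β≡γ ⟩
        γ
          ≡⟨ ℚₚ.+-identityʳ γ ⟨
        γ ℚ.+ 0ℚ
          <⟨ ℚₚ.+-monoʳ-< γ 0<γ ⟩
        γ ℚ.+ γ
          ≡⟨ γ+γ≡δ ⟩
        δ ∎
      where
      open ℚₚ.≤-Reasoning
      inA : ∀ {m} → (A ℕ.⊔ B) ℕ.⊔ (C ℕ.⊔ D) ℕ.≤ m → A ℕ.≤ m
      inA p = ℕₚ.m⊔n≤o⇒m≤o A B (ℕₚ.m⊔n≤o⇒m≤o (A ℕ.⊔ B) (C ℕ.⊔ D) p)
      inB : ∀ {m} → (A ℕ.⊔ B) ℕ.⊔ (C ℕ.⊔ D) ℕ.≤ m → B ℕ.≤ m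
      inB p = ℕₚ.m⊔n≤o⇒n≤o A B (ℕₚ.m⊔n≤o⇒m≤o (A ℕ.⊔ B) (C ℕ.⊔ D) p)
      inC : ∀ {m} → (A ℕ.⊔ B) ℕ.⊔ (C ℕ.⊔ D) ℕ.≤ m → C ℕ.≤ m
      inC p = ℕₚ.m⊔n≤o⇒m≤o C D (ℕₚ.m⊔n≤o⇒n≤o (A ℕ.⊔ B) (C ℕ.⊔ D) p)
      inD : ∀ {m} → (A ℕ.⊔ B) ℕ.⊔ (C ℕ.⊔ D) ℕ.≤ m → D ℕ.≤ m
      inD p = ℕₚ.m⊔n≤o⇒n≤o C D (ℕₚ.m⊔n≤o⇒n≤o (A ℕ.⊔ B) (C ℕ.⊔ D) p)

infixl 7 _*ᴿ_
infixl 6 _+ᴿ_ _-ᴿ_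
infix  4 _<ᴿ_ _≤ᴿ_

fromℚ : ℚ → ℝ
fromℚ q = mkℝ (λ _ → q) (const-cauchy q)

0ᴿ 1ᴿ : ℝ
0ᴿ = fromℚ 0ℚ
1ᴿ = fromℚ 1ℚ

_+ᴿ_ _-ᴿ_ _*ᴿ_ : ℝ → ℝ → ℝ
x +ᴿ y = mkℝ (λ n → seq x n ℚ.+ seq y n)
             (+-cauchy (seq x) (seq y) (cauchy x) (cauchy y))
x -ᴿ y = mkℝ (λ n → seq x n ℚ.- seq y n)
             (+-cauchy (seq x) (λ n → ℚ.- seq y n) (cauchy x) (neg-cauchy (seq y) (cauchy y)))
x *ᴿ y = mkℝ (λ n → seq x n ℚ.* seq y n)
             (*-cauchy (seq x) (seq y) (cauchy x) (cauchy y))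

_<ᴿ_ _≤ᴿ_ : Rel ℝ _
x <ᴿ y = ∃ λ δ → 0ℚ ℚ.< δ × ∃ λ N → ∀ n → N ℕ.≤ n → seq x n ℚ.+ δ ℚ.≤ seq y n
x ≤ᴿ y = ¬ (y <ᴿ x)

[0,1] : Set
[0,1] = Σ ℝ λ ε → 0ᴿ ≤ᴿ ε × ε ≤ᴿ 1ᴿ

infix 4 _≤ᴵ_

_≤ᴵ_ : Rel [0,1] _
ε ≤ᴵ ε′ = proj₁ ε ≤ᴿ proj₁ ε′

∑ : {A : Set} → List A → (A → ℝ) → ℝ
∑ xs f = foldr (λ x s → f x +ᴿ s) 0ᴿ xs

-- A number is given by the set of rationals strictly below it; +∞ is the
-- cut containing all of them.  (There is no -∞, the cut being inhabited.)
record ℝ∞ : Set₁ where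
  field
    Below     : ℚ → Set
    inhabited : ∃ Below
    downward  : ∀ {p q} → p ℚ.< q → Below q → Below p
    rounded   : ∀ {q} → Below q → ∃ λ r → q ℚ.< r × Below r

open ℝ∞ public

infix 4 _≤∞_

_≤∞_ : Rel ℝ∞ _
x ≤∞ y = ∀ q → Below x q → Below y q

partial : (ℕ → ℝ) → ℕ → ℝ
partial f zero    = 0ᴿ
partial f (suc n) = partial f n +ᴿ f n

-- The least upper bound of the partial sums; this is the sum of the series
-- when, as below, the terms are non-negative.
∑∞ : (ℕ → ℝ) → ℝ∞
∑∞ f = record
  { Below     = λ q → ∃ λ n → fromℚ q <ᴿ partial f n
  ; inhabited = ℚ.- 1ℚ , 0 , 1ℚ , 0<1 , 0 , λ _ _ → ℚₚ.≤-refl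
  ; downward  = λ { p<q (n , δ , 0<δ , N , h) →
      n , δ , 0<δ , N , λ m N≤m →
        ℚₚ.≤-trans (ℚₚ.+-monoˡ-≤ δ (ℚₚ.<⇒≤ p<q)) (h m N≤m) }
  ; rounded   = λ { {q} (n , δ , 0<δ , N , h) → let (η , 0<η , η+η≡δ) = halve δ 0<δ in
      q ℚ.+ η
      , subst (ℚ._< q ℚ.+ η) (ℚₚ.+-identityʳ q) (ℚₚ.+-monoʳ-< q 0<η)
      , n , η , 0<η , N , λ m N≤m →
          subst (ℚ._≤ seq (partial f n) m)
                (trans (cong (q ℚ.+_) (sym η+η≡δ)) (sym (ℚₚ.+-assoc q η η)))
                (h m N≤m) }
  }

δ : Term → Term → ℝ
δ M N with M ≟ N
... | yes _ = 1ᴿ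
... | no  _ = 0ᴿ

P : [0,1] → Term → Maybe (Term → ℝ)
P (ε , _) M = Maybe.zipWith
  (λ L R N → ε *ᴿ δ L N +ᴿ (1ᴿ -ᴿ ε) *ᴿ δ R N) (LO M) (RI M)

ℙ : [0,1] → Term → Term → ℝ
ℙ ε M N = maybe′ (λ μ → μ N) 0ᴿ (P ε M)

successors : Term → List Term
successors M = fromMaybe (LO M) ++ fromMaybe (RI M)

-- The terms reachable by i steps of LO or RI, without repetitions.  ρ i
-- vanishes outside this list (see ρ-vanishes), so that the sums over all
-- terms are sums over it.
reach : Term → ℕ → List Term
reach M zero    = M ∷ []
reach M (suc i) = deduplicate _≟_ (concatMap successors (reach M i))

ρ : [0,1] → Term → ℕ → Term → ℝ
ρ ε M zero    N = δ M N
ρ ε M (suc i) N = ∑ (reach M i) λ L → ρ ε M i L *ᴿ ℙ ε L N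

∣ρ∣ : [0,1] → Term → ℕ → ℝ
∣ρ∣ ε M i = ∑ (reach M i) (ρ ε M i)

ExpLen : Term → [0,1] → ℝ∞
ExpLen M ε = ∑∞ λ i → ∣ρ∣ ε M (suc i)

NonDecreasing NonIncreasing : ([0,1] → ℝ∞) → Set
NonDecreasing f = f Preserves _≤ᴵ_ ⟶ _≤∞_
NonIncreasing f = f Preserves _≤ᴵ_ ⟶ flip _≤∞_

private
  δ-vanishes : ∀ M N → ¬ M ≡ N → ∀ n → seq (δ M N) n ≡ 0ℚ
  δ-vanishes M N M≢N n with M ≟ N
  ... | yes M≡N = ⊥-elim (M≢N M≡N)
  ... | no  _   = refl

  ℙ-vanishes : ∀ ε L {N} → N ∉ successors L → ∀ n → seq (ℙ ε L N) n ≡ 0ℚ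
  ℙ-vanishes (ε , _) L N∉ n with LO L | RI L
  ... | nothing | _       = refl
  ... | just _  | nothing = refl
  ... | just A  | just B  = cong₂ ℚ._+_
    (trans (cong (seq ε n ℚ.*_) (δ-vanishes A _ (λ { refl → N∉ (here refl) }) n))
           (ℚₚ.*-zeroʳ (seq ε n)))
    (trans (cong ((1ℚ ℚ.- seq ε n) ℚ.*_) (δ-vanishes B _ (λ { refl → N∉ (there (here refl)) }) n))
           (ℚₚ.*-zeroʳ (1ℚ ℚ.- seq ε n)))

  ∑-vanishes : ∀ {A : Set} (xs : List A) (f : A → ℝ) n →
    (∀ {x} → x ∈ xs → seq (f x) n ≡ 0ℚ) → seq (∑ xs f) n ≡ 0ℚ
  ∑-vanishes []       f n h = refl
  ∑-vanishes (x ∷ xs) f n h = cong₂ ℚ._+_ (h (here refl)) (∑-vanishes xs f n (h ∘ there))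

  ∈-concatMap : ∀ {A B : Set} (f : A → List B) {x y} xs →
    x ∈ xs → y ∈ f x → y ∈ concatMap f xs
  ∈-concatMap f (x ∷ xs) (here refl) y∈ = ∈-++⁺ˡ y∈
  ∈-concatMap f (x ∷ xs) (there x∈)  y∈ = ∈-++⁺ʳ (f x) (∈-concatMap f xs x∈ y∈)

ρ-vanishes : ∀ ε M i {N} → N ∉ reach M i → ∀ n → seq (ρ ε M i N) n ≡ 0ℚ
ρ-vanishes ε M zero    N∉ n = δ-vanishes M _ (λ { refl → N∉ (here refl) }) n
ρ-vanishes ε M (suc i) {N} N∉ n = ∑-vanishes (reach M i) (λ L → ρ ε M i L *ᴿ ℙ ε L N) n λ {L} L∈ →
  trans (cong (seq (ρ ε M i L) n ℚ.*_)
          (ℙ-vanishes ε L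
            (λ N∈ → N∉ (∈-deduplicate⁺ _≟_ (∈-concatMap successors (reach M i) L∈ N∈))) n))
        (ℚₚ.*-zeroʳ (seq (ρ ε M i L) n))

module Submission where

open import Defs
open import Data.Integer.Base using (+_)
open import Data.List.Base using ([])
open import Data.Nat.Base as ℕ using (ℕ; suc; z≤n; s≤s)
import Data.Nat.Properties as ℕₚ
open import Data.Product.Base using (∃-syntax; _×_; _,_)
open import Data.Rational.Base as ℚ using (ℚ; 0ℚ; 1ℚ; ½)
import Data.Rational.Properties as ℚₚ
open import Data.Sum.Base using (inj₁; inj₂)
open import Relation.Binary.PropositionalEquality using (_≡_; refl; trans)
open import Relation.Nullary using (¬_)
open import Relation.Nullary.Decidable using (from-yes)

-- Three biases suffice.  Both witnesses normalise within a few steps whatever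
-- redexes are chosen, so ExpLen is a polynomial in ε: 2 + ε(1 − ε) for the
-- affine witness and 4 − ε(1 − ε) for the λI one.  Each takes equal values at
-- 0 and 1 and a different one at ½.

pointwise⇒≤ᴿ : ∀ x y → (∀ n → seq x n ℚ.≤ seq y n) → x ≤ᴿ y
pointwise⇒≤ᴿ x y x≤y (δ , 0<δ , N , y+δ≤x) = ℚₚ.<-irrefl refl (begin-strict
  seq y N         ≡⟨ ℚₚ.+-identityʳ (seq y N) ⟨
  seq y N ℚ.+ 0ℚ  <⟨ ℚₚ.+-monoʳ-< (seq y N) 0<δ ⟩
  seq y N ℚ.+ δ   ≤⟨ y+δ≤x N ℕₚ.≤-refl ⟩
  seq x N         ≤⟨ x≤y N ⟩
  seq y N         ∎)
  where open ℚₚ.≤-Reasoning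

fromℚ-mono : ∀ {p q} → p ℚ.≤ q → fromℚ p ≤ᴿ fromℚ q
fromℚ-mono {p} {q} p≤q = pointwise⇒≤ᴿ (fromℚ p) (fromℚ q) λ _ → p≤q

fromℚᴵ : ∀ q → 0ℚ ℚ.≤ q → q ℚ.≤ 1ℚ → [0,1]
fromℚᴵ q 0≤q q≤1 = fromℚ q , fromℚ-mono 0≤q , fromℚ-mono q≤1

0≤½ : 0ℚ ℚ.≤ ½
0≤½ = from-yes (0ℚ ℚₚ.≤? ½)

½≤1 : ½ ℚ.≤ 1ℚ
½≤1 = from-yes (½ ℚₚ.≤? 1ℚ)

0≤1 : 0ℚ ℚ.≤ 1ℚ
0≤1 = ℚₚ.≤-trans 0≤½ ½≤1

0ᴵ ½ᴵ 1ᴵ : [0,1]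
0ᴵ = fromℚᴵ 0ℚ ℚₚ.≤-refl 0≤1
½ᴵ = fromℚᴵ ½ 0≤½ ½≤1
1ᴵ = fromℚᴵ 1ℚ 0≤1 ℚₚ.≤-refl

0ᴵ≤½ᴵ : 0ᴵ ≤ᴵ ½ᴵ
0ᴵ≤½ᴵ = fromℚ-mono 0≤½

½ᴵ≤1ᴵ : ½ᴵ ≤ᴵ 1ᴵ
½ᴵ≤1ᴵ = fromℚ-mono ½≤1

lengthUpTo : Term → [0,1] → ℕ → ℝ
lengthUpTo M ε = partial (λ i → ∣ρ∣ ε M (suc i))

reach-[] : ∀ M {K n} → K ℕ.≤′ n → reach M K ≡ [] → reach M n ≡ []
reach-[] M ℕ.≤′-refl       eq = eq
reach-[] M (ℕ.≤′-step K≤n) eq rewrite reach-[] M K≤n eq = refl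

-- Each term added after `K` is a sum over an empty list.
lengthUpTo-stationary : ∀ M ε {K n} → K ℕ.≤′ n → reach M K ≡ [] →
  ∀ m → seq (lengthUpTo M ε n) m ≡ seq (lengthUpTo M ε K) m
lengthUpTo-stationary M ε ℕ.≤′-refl eq m = refl
lengthUpTo-stationary M ε {n = suc n} (ℕ.≤′-step K≤n) eq m
  rewrite reach-[] M K≤n eq =
  trans (ℚₚ.+-identityʳ _) (lengthUpTo-stationary M ε K≤n eq m)

-- From `K` on the partial sums are constant, so finitely many comparisons bound them all. The range
-- `n < suc K` includes `K` and is the form that `allUpTo?` decides.
lengthUpTo-≤ : ∀ M ε K {q} → reach M K ≡ [] →
  (∀ m {n} → n ℕ.< suc K → seq (lengthUpTo M ε n) m ℚ.≤ q) →
  ∀ n m → seq (lengthUpTo M ε n) m ℚ.≤ q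
lengthUpTo-≤ M ε K eq bounded n m with ℕₚ.≤-total n K
... | inj₁ n≤K = bounded m (s≤s n≤K)
... | inj₂ K≤n = ℚₚ.≤-trans
  (ℚₚ.≤-reflexive (lengthUpTo-stationary M ε (ℕₚ.≤⇒≤′ K≤n) eq m))
  (bounded m ℕₚ.≤-refl)

-- The rational `q` separates the two cuts: the `K`-th partial sum at `ε` exceeds it by the gap `δ`,
-- and no partial sum at `ε′` exceeds it.
ExpLen-≰ : ∀ M ε ε′ K q δ → 0ℚ ℚ.< δ → reach M K ≡ [] →
  (∀ m → q ℚ.+ δ ℚ.≤ seq (lengthUpTo M ε K) m) →
  (∀ m {n} → n ℕ.< suc K → seq (lengthUpTo M ε′ n) m ℚ.≤ q) →
  ¬ ExpLen M ε ≤∞ ExpLen M ε′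
ExpLen-≰ M ε ε′ K q δ 0<δ eq lower upper ≤∞
  with ≤∞ q (K , δ , 0<δ , 0 , λ m _ → lower m)
... | n , q<ᴿ = pointwise⇒≤ᴿ (lengthUpTo M ε′ n) (fromℚ q)
  (lengthUpTo-≤ M ε′ K eq upper n) q<ᴿ

-- The gap ¼ is ε(1 - ε) at ε = ½.
0<¼ : 0ℚ ℚ.< + 1 ℚ./ 4
0<¼ = from-yes (0ℚ ℚₚ.<? + 1 ℚ./ 4)

I : Term
I = ƛ var 0

-- The term (λx. (λy. z)(λw. x w)) I with z free. Firing the outer redex creates I w inside an
-- argument about to be erased. `LO` then `RI` wastes a step on it, for three steps in all; every
-- other run takes two.
affine : Term
affine = (ƛ (ƛ var 2) · (ƛ var 1 · var 0)) · I

affine-Λ-A : Λ-A affine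
affine-Λ-A _ (appˡ self)               = s≤s z≤n
affine-Λ-A _ (appˡ (body (appˡ self))) = z≤n
affine-Λ-A _ (appˡ (body (appʳ self))) = s≤s z≤n
affine-Λ-A _ (appʳ self)               = s≤s z≤n
affine-Λ-A _ (appˡ (body (appˡ (body ()))))
affine-Λ-A _ (appˡ (body (appʳ (body (appˡ ())))))
affine-Λ-A _ (appˡ (body (appʳ (body (appʳ ())))))
affine-Λ-A _ (appʳ (body ()))

affine-½≰ : ∀ ε →
  (∀ m {n} → n ℕ.< 5 → seq (lengthUpTo affine ε n) m ℚ.≤ + 2 ℚ./ 1) →
  ¬ ExpLen affine ½ᴵ ≤∞ ExpLen affine ε
-- The normal form z is still in `reach affine 3`, hence 4. At a rational ε every sequence is
-- constant, so the sums evaluate for arbitrary `m`.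
affine-½≰ ε = ExpLen-≰ affine ½ᴵ ε 4 (+ 2 ℚ./ 1) (+ 1 ℚ./ 4) 0<¼ refl λ m →
  from-yes (+ 9 ℚ./ 4 ℚₚ.≤? seq (lengthUpTo affine ½ᴵ 4) m)

affine-½≰0 : ¬ ExpLen affine ½ᴵ ≤∞ ExpLen affine 0ᴵ
affine-½≰0 = affine-½≰ 0ᴵ λ m → from-yes
  (ℕₚ.allUpTo? (λ n → seq (lengthUpTo affine 0ᴵ n) m ℚₚ.≤? + 2 ℚ./ 1) 5)

affine-½≰1 : ¬ ExpLen affine ½ᴵ ≤∞ ExpLen affine 1ᴵ
affine-½≰1 = affine-½≰ 1ᴵ λ m → from-yes
  (ℕₚ.allUpTo? (λ n → seq (lengthUpTo affine 1ᴵ n) m ℚₚ.≤? + 2 ℚ./ 1) 5)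

-- The term (λx. (λy. y y)(x z)) I with z free. Here the created redex I z is about to be
-- duplicated: `LO` then `RI` fires it once, for three steps in all; every other run takes four.
relevant : Term
relevant = (ƛ (ƛ var 0 · var 0) · (var 0 · var 1)) · I

relevant-Λ-I : Λ-I relevant
relevant-Λ-I _ (appˡ self)               = s≤s z≤n
relevant-Λ-I _ (appˡ (body (appˡ self))) = s≤s z≤n
relevant-Λ-I _ (appʳ self)               = s≤s z≤n
relevant-Λ-I _ (appˡ (body (appˡ (body (appˡ ())))))
relevant-Λ-I _ (appˡ (body (appˡ (body (appʳ ())))))
relevant-Λ-I _ (appˡ (body (appʳ (appˡ ()))))
relevant-Λ-I _ (appˡ (body (appʳ (appʳ ()))))
relevant-Λ-I _ (appʳ (body ()))

relevant-≰½ : ∀ ε → (∀ m → + 4 ℚ./ 1 ℚ.≤ seq (lengthUpTo relevant ε 5) m) →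
  ¬ ExpLen relevant ε ≤∞ ExpLen relevant ½ᴵ
relevant-≰½ ε lower =
  -- 15/4 is 4 - ε(1 - ε) at ½; the normal form z z is still in `reach relevant 4`, hence 5.
  ExpLen-≰ relevant ε ½ᴵ 5 (+ 15 ℚ./ 4) (+ 1 ℚ./ 4) 0<¼ refl lower λ m → from-yes
    (ℕₚ.allUpTo? (λ n → seq (lengthUpTo relevant ½ᴵ n) m ℚₚ.≤? + 15 ℚ./ 4) 6)

relevant-0≰½ : ¬ ExpLen relevant 0ᴵ ≤∞ ExpLen relevant ½ᴵ
relevant-0≰½ = relevant-≰½ 0ᴵ λ m →
  from-yes (+ 4 ℚ./ 1 ℚₚ.≤? seq (lengthUpTo relevant 0ᴵ 5) m)

relevant-1≰½ : ¬ ExpLen relevant 1ᴵ ≤∞ ExpLen relevant ½ᴵ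
relevant-1≰½ = relevant-≰½ 1ᴵ λ m →
  from-yes (+ 4 ℚ./ 1 ℚₚ.≤? seq (lengthUpTo relevant 1ᴵ 5) m)

proposition5 : (∃[ M ] (Λ-A M × ¬ NonDecreasing (ExpLen M) × ¬ NonIncreasing (ExpLen M)))
    × (∃[ M ] (Λ-I M × ¬ NonDecreasing (ExpLen M) × ¬ NonIncreasing (ExpLen M)))
proposition5 =
  (affine , affine-Λ-A
    , (λ mono → affine-½≰1 (mono {½ᴵ} {1ᴵ} ½ᴵ≤1ᴵ))
    , (λ mono → affine-½≰0 (mono {0ᴵ} {½ᴵ} 0ᴵ≤½ᴵ)))
  , (relevant , relevant-Λ-I
    -- A dip at ½ instead of a peak swaps the roles of the two halves of the interval.
    , (λ mono → relevant-0≰½ (mono {0ᴵ} {½ᴵ} 0ᴵ≤½ᴵ))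
    , (λ mono → relevant-1≰½ (mono {½ᴵ} {1ᴵ} ½ᴵ≤1ᴵ)))
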